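{- Let $n\equiv 2\pmod 4$ with $n>2$. Then the ensemble of any $\mathrm{OA}(n+1,n)$ contains at least two Latin squares that are not isotopic to each other.
   Context: An orthogonal array $\mathrm{OA}(k,n)$ on an alphabet $\Lambda$ with $|\Lambda|=n$ is an $n^2\times k$ matrix $A=(a_{r\ell})$ with entries in $\Lambda$ such that in every pair of distinct columns each ordered pair in $\Lambda^2$ occurs in exactly one row. The ensemble of $A$ consists of the Latin squares obtained from each of the $\binom{k}{3}$ choices of columns $i<j<\ell$ of $A$: the Latin square for $i<j<\ell$ has rows and columns indexed by $\Lambda$, and for each row $r$ of $A$ its entry in row $a_{ri}$, column $a_{rj}$ is $a_{r\ell}$. Two Latin squares on $\Lambda$ are isotopic if one can be obtained from the other by permuting rows, permuting columns and permuting symbols (by three arbitrary permutations of $\Lambda$). -}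

module Defs where

open import Data.Nat.Base using (ℕ; _^_)
open import Data.Fin.Base using (Fin; _<_)
open import Data.Product.Base using (∃; ∃-syntax; _×_)
open import Data.Product using (∃!)
open import Function.Bundles using (_↔_; Inverse)
open import Relation.Binary.PropositionalEquality using (_≡_; _≢_)
open import Relation.Unary using (Pred)
open import Level using (0ℓ)

record OA (k n : ℕ) (Λ : Set) : Set where
  field
    alphabet   : Fin n ↔ Λ
    entry      : Fin (n ^ 2) → Fin k → Λ
    orthogonal : ∀ (i j : Fin k) → i ≢ j → ∀ (x y : Λ) →
                 ∃! _≡_ λ r → entry r i ≡ x × entry r j ≡ y

record LatinSquare (Λ : Set) : Set where
  field
    cell     : Λ → Λ → Λ
    rowLatin : ∀ x z → ∃! _≡_ λ y → cell x y ≡ z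
    colLatin : ∀ y z → ∃! _≡_ λ x → cell x y ≡ z

-- By orthogonality of the columns i and j, the equations below prescribe every
-- cell of L exactly once, so each choice i < j < l determines L.
Ensemble : ∀ {k n Λ} → OA k n Λ → Pred (LatinSquare Λ) 0ℓ
Ensemble A L =
  ∃[ i ] ∃[ j ] ∃[ l ] i < j × j < l ×
    (∀ r → cell (entry r i) (entry r j) ≡ entry r l)
  where
    open OA A
    open LatinSquare L

-- The permutations α, β and γ act on rows, columns and symbols of L.
Isotopic : ∀ {Λ} → LatinSquare Λ → LatinSquare Λ → Set
Isotopic {Λ} L M =
  ∃[ α ] ∃[ β ] ∃[ γ ] (∀ x y →
    M.cell (perm α x) (perm β y) ≡ perm γ (L.cell x y))
  where
    module L = LatinSquare L
    module M = LatinSquare M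
    perm : Λ ↔ Λ → Λ → Λ
    perm = Inverse.to

{-
For columns i, j, l let T i j l count the ordered pairs of rows that agree in
column l, increase in column i and decrease in column j; its parity is the
symbol parity of the Latin square on i, j, l.
* T i j l + T j k l + T i k l is even, since each unordered pair of rows is
  ordered differently by either none or exactly two of the pairs of columns.
* For even n the parity of T is an isotopy invariant: by the previous point,
  relabelling column i by α changes it by the number of pairs agreeing in l
  that α reverses in column i, and that number is a multiple of n.
* Any two rows agree in exactly one of the n + 1 columns, so T i j l summed over
  all l is the number of pairs of rows increasing in i and decreasing in j, which
  is (n (n - 1) / 2)² and odd for n ≡ 2 (mod 4).
Hence T 0 1 c is odd for some c, and one of T 0 1 3, T 1 2 3, T 0 2 3 is even.
-}
module Submission where

open import Data.Nat using (ℕ; suc; _<_; _%_)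
open import Data.Product using (∃₂; _×_)
open import Relation.Binary.PropositionalEquality using (_≡_)
open import Relation.Nullary using (¬_)
open import Relation.Unary using (_∈_)
open import Defs

open import Data.Fin as Fin using (Fin; zero; suc)
import Data.Fin.Properties as Fin
open import Data.Fin.Permutation using (Permutation; _⟨$⟩ʳ_)
open import Data.Fin.Patterns using (0F; 1F; 2F; 3F)
open import Data.Nat using (zero; parity; _+_; _*_; _^_; _/_; _≤_; z≤n; s≤s; z<s; s<s)
import Data.Nat.Properties as ℕ
open import Data.Nat.DivMod using (m≡m%n+[m/n]*n)
open import Data.Nat.Tactic.RingSolver using (solve-∀)
open import Data.Parity as ℙ using (0ℙ; 1ℙ)
import Data.Parity.Properties as ℙ
open import Data.Product using (∃; _,_; proj₁; proj₂)
open import Data.Sum using (_⊎_; inj₁; inj₂)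
open import Function using (_∘_; Injective; Inverse; Injection)
open import Function.Construct.Composition using (_↔-∘_)
open import Function.Construct.Symmetry using (↔-sym)
open import Function.Properties.Inverse using (↔⇒↣)
open import Relation.Binary using (tri<; tri≈; tri>)
open import Relation.Binary.PropositionalEquality
  using (_≢_; _≗_; refl; sym; trans; cong; cong₂; module ≡-Reasoning)
open import Relation.Nullary using (Dec; yes; no; contradiction)
open import Algebra.Properties.Semiring.Sum ℕ.+-*-semiring

private
  variable
    k m n : ℕ

-- Finite sums of natural numbers and their parity.

sum-const : ∀ n c → ∑[ i < n ] c ≡ n * c
sum-const zero    c = refl
sum-const (suc n) c = cong (c +_) (sum-const n c)

sum-single : ∀ (f : Fin n → ℕ) i → (∀ j → j ≢ i → f j ≡ 0) → sum f ≡ f i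
sum-single {suc n} f i off = begin
  sum f                                ≡⟨ sum-remove f ⟩
  f i + sum (λ j → f (Fin.punchIn i j)) ≡⟨ cong (f i +_) (sum-cong-≗ λ j → off _ (Fin.punchInᵢ≢i i j)) ⟩
  f i + ∑[ j < n ] 0                   ≡⟨ cong (f i +_) (sum-replicate-zero n) ⟩
  f i + 0                              ≡⟨ ℕ.+-identityʳ (f i) ⟩
  f i                                  ∎
  where open ≡-Reasoning

sum-mono-≤ : ∀ {f g : Fin n → ℕ} → (∀ i → f i ≤ g i) → sum f ≤ sum g
sum-mono-≤ {zero}  f≤g = z≤n
sum-mono-≤ {suc n} f≤g = ℕ.+-mono-≤ (f≤g zero) (sum-mono-≤ (f≤g ∘ suc))

-- Bounding all terms other than the one at `i` and cancelling them from the equal totals leaves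
-- `g i ≤ f i`.
sum-tight : ∀ {f g : Fin n → ℕ} → (∀ i → f i ≤ g i) → sum f ≡ sum g → f ≗ g
sum-tight {suc n} {f} {g} f≤g Σf≡Σg i =
  ℕ.≤-antisym (f≤g i) (ℕ.+-cancelʳ-≤ Rf (g i) (f i) (begin
    g i + Rf                        ≤⟨ ℕ.+-monoʳ-≤ (g i) (sum-mono-≤ (f≤g ∘ Fin.punchIn i)) ⟩
    g i + sum (g ∘ Fin.punchIn i)   ≡⟨ sum-remove g ⟨
    sum g                           ≡⟨ Σf≡Σg ⟨
    sum f                           ≡⟨ sum-remove f ⟩
    f i + Rf                        ∎))
  where
  open ℕ.≤-Reasoning
  Rf = sum (f ∘ Fin.punchIn i)

odd-sum : ∀ (f : Fin n → ℕ) → parity (sum f) ≡ 1ℙ → ∃ λ i → parity (f i) ≡ 1ℙ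
odd-sum {suc n} f odd with parity (f zero) in eq
... | 1ℙ = zero , eq
... | 0ℙ with odd-sum (f ∘ suc) (trans (sym (trans (ℙ.+-homo-+ (f zero) (sum (f ∘ suc))) (cong (ℙ._+ parity (sum (f ∘ suc))) eq))) odd)
...   | i , p = suc i , p

∑∑-cong : ∀ {g h : Fin m → Fin n → ℕ} → (∀ r s → g r s ≡ h r s) →
          ∑[ r < m ] ∑[ s < n ] g r s ≡ ∑[ r < m ] ∑[ s < n ] h r s
∑∑-cong g≡h = sum-cong-≗ λ r → sum-cong-≗ (g≡h r)

∑∑-distrib-+ : ∀ (g h : Fin m → Fin n → ℕ) →
  ∑[ r < m ] ∑[ s < n ] (g r s + h r s) ≡
  ∑[ r < m ] ∑[ s < n ] g r s + ∑[ r < m ] ∑[ s < n ] h r s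
∑∑-distrib-+ g h = trans (sum-cong-≗ λ r → ∑-distrib-+ (g r) (h r)) (∑-distrib-+ (λ r → sum (g r)) (λ r → sum (h r)))

∑∑-*ˡ : ∀ c (g : Fin m → Fin n → ℕ) →
  ∑[ r < m ] ∑[ s < n ] (c * g r s) ≡ c * ∑[ r < m ] ∑[ s < n ] g r s
∑∑-*ˡ c g = sym (trans (*-distribˡ-sum c (λ r → sum (g r))) (sum-cong-≗ λ r → *-distribˡ-sum c (g r)))

∑∑-symmetrize : ∀ (g : Fin m → Fin m → ℕ) →
  ∑[ r < m ] ∑[ s < m ] (g r s + g s r) ≡ 2 * ∑[ r < m ] ∑[ s < m ] g r s
∑∑-symmetrize {m} g = begin
  ∑[ r < m ] ∑[ s < m ] (g r s + g s r)                            ≡⟨ ∑∑-distrib-+ g (λ r s → g s r) ⟩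
  Σg + ∑[ r < m ] ∑[ s < m ] g s r                                 ≡⟨ cong (Σg +_) (∑-comm g) ⟨
  Σg + Σg                                                          ≡⟨ cong (Σg +_) (ℕ.+-identityʳ Σg) ⟨
  2 * Σg                                                           ∎
  where
  open ≡-Reasoning
  Σg = ∑[ r < m ] ∑[ s < m ] g r s

-- Doubling either side gives its symmetrized sum, so the summands need to match only per unordered
-- pair of indices.
∑∑-unordered : ∀ (g h : Fin m → Fin m → ℕ) → (∀ r s → g r s + g s r ≡ h r s + h s r) →
  ∑[ r < m ] ∑[ s < m ] g r s ≡ ∑[ r < m ] ∑[ s < m ] h r s
∑∑-unordered g h eq = ℕ.*-cancelˡ-≡ _ _ 2
  (trans (sym (∑∑-symmetrize g)) (trans (∑∑-cong eq) (∑∑-symmetrize h)))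

-- Numerical indicators of equality and order.

⟦_⟧ : {P : Set} → Dec P → ℕ
⟦ yes _ ⟧ = 1
⟦ no  _ ⟧ = 0

-- Kept opaque so that `δ` and `lt` stay atomic in goals and are evaluated only through the four
-- lemmas of this block.
opaque
  δ lt : Fin n → Fin n → ℕ
  δ  x y = ⟦ x Fin.≟ y ⟧
  lt x y = ⟦ x Fin.<? y ⟧

  δ-≡ : ∀ {x y : Fin n} → x ≡ y → δ x y ≡ 1
  δ-≡ {x = x} {y} x≡y with x Fin.≟ y
  ... | yes _  = refl
  ... | no x≢y = contradiction x≡y x≢y

  δ-≢ : ∀ {x y : Fin n} → x ≢ y → δ x y ≡ 0
  δ-≢ {x = x} {y} x≢y with x Fin.≟ y
  ... | yes x≡y = contradiction x≡y x≢y
  ... | no _    = refl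

  lt-< : ∀ {x y : Fin n} → x Fin.< y → lt x y ≡ 1
  lt-< {x = x} {y} x<y with x Fin.<? y
  ... | yes _  = refl
  ... | no x≮y = contradiction x<y x≮y

  lt-≮ : ∀ {x y : Fin n} → ¬ x Fin.< y → lt x y ≡ 0
  lt-≮ {x = x} {y} x≮y with x Fin.<? y
  ... | yes x<y = contradiction x<y x≮y
  ... | no _    = refl

δ-injective : ∀ {f : Fin m → Fin n} → Injective _≡_ _≡_ f → ∀ x y → δ (f x) (f y) ≡ δ x y
δ-injective inj x y with x Fin.≟ y
... | yes refl = trans (δ-≡ refl) (sym (δ-≡ refl))
... | no x≢y   = trans (δ-≢ (x≢y ∘ inj)) (sym (δ-≢ x≢y))

sum-δ : ∀ (x : Fin n) (f : Fin n → ℕ) → ∑[ y < n ] (δ x y * f y) ≡ f x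
sum-δ x f = begin
  sum (λ y → δ x y * f y)  ≡⟨ sum-single (λ y → δ x y * f y) x (λ y y≢x → cong (_* f y) (δ-≢ (y≢x ∘ sym))) ⟩
  δ x x * f x              ≡⟨ cong (_* f x) (δ-≡ refl) ⟩
  1 * f x                  ≡⟨ ℕ.*-identityˡ (f x) ⟩
  f x                      ∎
  where open ≡-Reasoning

sum-δ-1 : ∀ (x : Fin n) → sum (δ x) ≡ 1
sum-δ-1 x = trans (sum-cong-≗ λ y → sym (ℕ.*-identityʳ (δ x y))) (sum-δ x (λ _ → 1))

lt-irrefl : ∀ {x y : Fin n} → x ≡ y → lt x y ≡ 0
lt-irrefl x≡y = lt-≮ (Fin.<-irrefl x≡y)

-- Given by equations between values, so that matching on `refl` lets `three-orders` be checked by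
-- computation.
Opposite : ℕ → ℕ → Set
Opposite a a′ = a ≡ 1 × a′ ≡ 0 ⊎ a ≡ 0 × a′ ≡ 1

lt-connex : ∀ {x y : Fin n} → x ≢ y → Opposite (lt x y) (lt y x)
lt-connex {x = x} {y} x≢y with Fin.<-cmp x y
... | tri< x<y _ y≮x = inj₁ (lt-< x<y , lt-≮ y≮x)
... | tri≈ _ x≡y _   = contradiction x≡y x≢y
... | tri> x≮y _ y<x = inj₂ (lt-≮ x≮y , lt-< y<x)

lt+gt+δ : ∀ (x y : Fin n) → (lt x y + lt y x) + δ x y ≡ 1
lt+gt+δ x y with x Fin.≟ y
... | yes x≡y rewrite lt-irrefl x≡y | lt-irrefl (sym x≡y) | δ-≡ x≡y = refl
... | no x≢y with lt-connex x≢y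
...   | inj₁ (p , q) rewrite p | q | δ-≢ x≢y = refl
...   | inj₂ (p , q) rewrite p | q | δ-≢ x≢y = refl

ascents : ℕ → ℕ
ascents n = ∑[ x < n ] ∑[ y < n ] lt x y

-- Trichotomy applied to all ordered pairs; the form avoids the subtraction and division in n (n -
-- 1) / 2.
2*ascents : ∀ n → 2 * ascents n + n ≡ n * n
2*ascents n = begin
  2 * ascents n + n
    ≡⟨ cong₂ _+_ (∑∑-symmetrize {n} lt) (trans (sum-cong-≗ (sum-δ-1 {n})) (trans (sum-const n 1) (ℕ.*-identityʳ n))) ⟨
  ∑[ x < n ] ∑[ y < n ] (lt x y + lt y x) + ∑[ x < n ] ∑[ y < n ] δ x y
    ≡⟨ ∑∑-distrib-+ {n} (λ x y → lt x y + lt y x) δ ⟨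
  ∑[ x < n ] ∑[ y < n ] ((lt x y + lt y x) + δ x y)
    ≡⟨ ∑∑-cong {n} lt+gt+δ ⟩
  ∑[ x < n ] ∑[ y < n ] 1
    ≡⟨ trans (sum-cong-≗ {n} (λ _ → trans (sum-const n 1) (ℕ.*-identityʳ n))) (sum-const n n) ⟩
  n * n ∎
  where
  open ≡-Reasoning

parity-2* : ∀ x → parity (2 * x) ≡ 0ℙ
parity-2* x = ℙ.*-homo-* 2 x

odd-ascents : ∀ n → n % 4 ≡ 2 → parity (ascents n) ≡ 1ℙ
odd-ascents n n%4≡2 = trans (cong parity P≡) (trans (ℙ.+-homo-+ 1 (2 * t)) (cong (1ℙ ℙ.+_) (parity-2* t)))
  where
  q t : ℕ
  q = n / 4
  -- For n = 2 + 4q, n (n - 1) / 2 = (1 + 2q)(1 + 4q) = 1 + 2t.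
  t = 4 * (q * q) + 3 * q
  n≡ : n ≡ 2 + q * 4
  n≡ = trans (m≡m%n+[m/n]*n n 4) (cong (_+ q * 4) n%4≡2)
  expand : ∀ q → (2 + q * 4) * (2 + q * 4) ≡ 2 * (1 + 2 * (4 * (q * q) + 3 * q)) + (2 + q * 4)
  expand = solve-∀
  P≡ : ascents n ≡ 1 + 2 * t
  P≡ = ℕ.*-cancelˡ-≡ _ _ 2 (ℕ.+-cancelʳ-≡ n _ _
    (trans (2*ascents n) (trans (cong (λ z → z * z) n≡)
      (trans (expand q) (cong (2 * (1 + 2 * t) +_) (sym n≡))))))

-- Discordant pairs of rows and the triangle relation.

opaque
  -- The count T of the overview, taken for arbitrary functions so that it also covers relabelled
  -- columns such as `f ∘ col i`.
  discord : (F G C : Fin m → Fin n) → ℕ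
  discord {m} F G C = ∑[ r < m ] ∑[ s < m ] (δ (C r) (C s) * (lt (F r) (F s) * lt (G s) (G r)))

  discord-def : ∀ (F G C : Fin m → Fin n) →
    discord F G C ≡ ∑[ r < m ] ∑[ s < m ] (δ (C r) (C s) * (lt (F r) (F s) * lt (G s) (G r)))
  discord-def F G C = refl

JointlyInjective : (F C : Fin m → Fin n) → Set
JointlyInjective F C = ∀ {r s} → F r ≡ F s → C r ≡ C s → r ≡ s

-- `a`, `b`, `c` tell whether F, G, H place r before s, and the primed variables tell the reverse.
-- The left side counts the disagreeing pairs among the three orders, which is 0 or 2. The right
-- side is twice the indicator that not all three agree, split by the order under F.
three-orders : ∀ {a a′ b b′ c c′} → Opposite a a′ → Opposite b b′ → Opposite c c′ →
  (a * b′ + b * c′ + a * c′) + (a′ * b + b′ * c + a′ * c) ≡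
  2 * (a * (b′ + b * c′)) + 2 * (a′ * (b + b′ * c))
three-orders (inj₁ (refl , refl)) (inj₁ (refl , refl)) (inj₁ (refl , refl)) = refl
three-orders (inj₁ (refl , refl)) (inj₁ (refl , refl)) (inj₂ (refl , refl)) = refl
three-orders (inj₁ (refl , refl)) (inj₂ (refl , refl)) (inj₁ (refl , refl)) = refl
three-orders (inj₁ (refl , refl)) (inj₂ (refl , refl)) (inj₂ (refl , refl)) = refl
three-orders (inj₂ (refl , refl)) (inj₁ (refl , refl)) (inj₁ (refl , refl)) = refl
three-orders (inj₂ (refl , refl)) (inj₁ (refl , refl)) (inj₂ (refl , refl)) = refl
three-orders (inj₂ (refl , refl)) (inj₂ (refl , refl)) (inj₁ (refl , refl)) = refl
three-orders (inj₂ (refl , refl)) (inj₂ (refl , refl)) (inj₂ (refl , refl)) = refl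

module _ (F G H C : Fin m → Fin n)
         (F-inj : JointlyInjective F C) (G-inj : JointlyInjective G C) (H-inj : JointlyInjective H C)
  where

  private
    w v : Fin m → Fin m → ℕ
    w r s = lt (F r) (F s) * lt (G s) (G r) + lt (G r) (G s) * lt (H s) (H r)
          + lt (F r) (F s) * lt (H s) (H r)
    -- Indicates F r < F s with r and s not ordered alike by all of F, G and H.
    v r s = lt (F r) (F s) * (lt (G s) (G r) + lt (G r) (G s) * lt (H s) (H r))

    w-v : ∀ r s → r ≢ s → C r ≡ C s → w r s + w s r ≡ 2 * v r s + 2 * v s r
    w-v r s r≢s e = three-orders
      (lt-connex λ p → r≢s (F-inj p e)) (lt-connex λ p → r≢s (G-inj p e)) (lt-connex λ p → r≢s (H-inj p e))

    δw-δv : ∀ r s → δ (C r) (C s) * w r s + δ (C s) (C r) * w s r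
                  ≡ 2 * (δ (C r) (C s) * v r s) + 2 * (δ (C s) (C r) * v s r)
    δw-δv r s with r Fin.≟ s
    ... | yes refl rewrite δ-≡ {x = C r} refl | lt-irrefl {x = F r} refl | lt-irrefl {x = G r} refl = refl
    ... | no r≢s with C r Fin.≟ C s
    ...   | yes e rewrite δ-≡ e | δ-≡ (sym e) = begin
      1 * w r s + 1 * w s r                ≡⟨ cong₂ _+_ (ℕ.*-identityˡ (w r s)) (ℕ.*-identityˡ (w s r)) ⟩
      w r s + w s r                        ≡⟨ w-v r s r≢s e ⟩
      2 * v r s + 2 * v s r                ≡⟨ cong₂ (λ x y → 2 * x + 2 * y) (ℕ.*-identityˡ (v r s)) (ℕ.*-identityˡ (v s r)) ⟨
      2 * (1 * v r s) + 2 * (1 * v s r)    ∎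
      where open ≡-Reasoning
    ...   | no ne rewrite δ-≢ ne | δ-≢ (ne ∘ sym) = refl

  discord-triangle : parity (discord F G C + discord G H C + discord F H C) ≡ 0ℙ
  discord-triangle = trans (cong parity total) (parity-2* Σv)
    where
    open ≡-Reasoning
    factor : ∀ d x y z → d * x + d * y + d * z ≡ d * (x + y + z)
    factor = solve-∀
    _∙_ : (Fin m → Fin m → ℕ) → (Fin m → Fin m → ℕ) → Fin m → Fin m → ℕ
    (f ∙ g) r s = f r s * g r s
    D fg gh fh : Fin m → Fin m → ℕ
    D  r s = δ (C r) (C s)
    fg r s = lt (F r) (F s) * lt (G s) (G r)
    gh r s = lt (G r) (G s) * lt (H s) (H r)
    fh r s = lt (F r) (F s) * lt (H s) (H r)
    ∑∑ : (Fin m → Fin m → ℕ) → ℕ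
    ∑∑ f = ∑[ r < m ] ∑[ s < m ] f r s
    Σv = ∑∑ (D ∙ v)
    total : discord F G C + discord G H C + discord F H C ≡ 2 * Σv
    total = begin
      discord F G C + discord G H C + discord F H C
        ≡⟨ cong₂ _+_ (cong₂ _+_ (discord-def F G C) (discord-def G H C)) (discord-def F H C) ⟩
      ∑∑ (D ∙ fg) + ∑∑ (D ∙ gh) + ∑∑ (D ∙ fh)
        ≡⟨ cong (_+ ∑∑ (D ∙ fh)) (∑∑-distrib-+ (D ∙ fg) (D ∙ gh)) ⟨
      ∑[ r < m ] ∑[ s < m ] ((D ∙ fg) r s + (D ∙ gh) r s) + ∑∑ (D ∙ fh)
        ≡⟨ ∑∑-distrib-+ (λ r s → (D ∙ fg) r s + (D ∙ gh) r s) (D ∙ fh) ⟨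
      ∑[ r < m ] ∑[ s < m ] ((D ∙ fg) r s + (D ∙ gh) r s + (D ∙ fh) r s)
        ≡⟨ ∑∑-cong (λ r s → factor (D r s) (fg r s) (gh r s) (fh r s)) ⟩
      ∑[ r < m ] ∑[ s < m ] (D ∙ w) r s
        -- `w` and `2 * v` can differ at a single ordered pair; they match only after adding the
        -- terms at (r, s) and (s, r).
        ≡⟨ ∑∑-unordered (D ∙ w) (λ r s → 2 * (D ∙ v) r s) δw-δv ⟩
      ∑[ r < m ] ∑[ s < m ] (2 * (D ∙ v) r s)
        ≡⟨ ∑∑-*ˡ 2 (D ∙ v) ⟩
      2 * Σv ∎

-- Columns of an orthogonal array, their Latin squares and sums over rows.

module Derived {Λ : Set} (A : OA k n Λ) where

  open OA A
  open Inverse alphabet using (to; from; strictlyInverseˡ; strictlyInverseʳ)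

  -- The alphabet carries no order; transporting letters to `Fin n` supplies the one used for
  -- counting.
  col : Fin k → Fin (n ^ 2) → Fin n
  col c r = from (entry r c)

  to-col : ∀ c r → to (col c r) ≡ entry r c
  to-col c r = strictlyInverseˡ (entry r c)

  row : ∀ {i j} → i ≢ j → Λ → Λ → Fin (n ^ 2)
  row i≢j x y = proj₁ (orthogonal _ _ i≢j x y)

  entry-rowˡ : ∀ {i j} (i≢j : i ≢ j) x y → entry (row i≢j x y) i ≡ x
  entry-rowˡ i≢j x y = proj₁ (proj₁ (proj₂ (orthogonal _ _ i≢j x y)))

  entry-rowʳ : ∀ {i j} (i≢j : i ≢ j) x y → entry (row i≢j x y) j ≡ y
  entry-rowʳ i≢j x y = proj₂ (proj₁ (proj₂ (orthogonal _ _ i≢j x y)))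

  row-unique : ∀ {i j} (i≢j : i ≢ j) {x y r} → entry r i ≡ x → entry r j ≡ y → row i≢j x y ≡ r
  row-unique i≢j p q = proj₂ (proj₂ (orthogonal _ _ i≢j _ _)) (p , q)

  col-injective : ∀ {i j} → i ≢ j → JointlyInjective (col i) (col j)
  col-injective {i} {j} i≢j {r} {s} p q =
    trans (sym (row-unique i≢j (entries i p) (entries j q))) (row-unique i≢j refl refl)
    where
    entries : ∀ c → col c r ≡ col c s → entry r c ≡ entry s c
    entries c e = trans (sym (to-col c r)) (trans (cong to e) (to-col c s))

  -- Orthogonality of i and j defines the cells, that of i and l gives the row condition, and that
  -- of j and l the column condition.
  square : ∀ {i j l} → i ≢ j → i ≢ l → j ≢ l → LatinSquare Λ
  square {i} {j} {l} i≢j i≢l j≢l = record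
    { cell     = λ x y → entry (row i≢j x y) l
    ; rowLatin = λ x z → entry (row i≢l x z) j
        , trans (cong (λ r → entry r l) (row-unique i≢j (entry-rowˡ i≢l x z) refl)) (entry-rowʳ i≢l x z)
        , λ {y} e → trans (cong (λ r → entry r j) (row-unique i≢l (entry-rowˡ i≢j x y) e)) (entry-rowʳ i≢j x y)
    ; colLatin = λ y z → entry (row j≢l y z) i
        , trans (cong (λ r → entry r l) (row-unique i≢j refl (entry-rowˡ j≢l y z))) (entry-rowʳ j≢l y z)
        , λ {x} e → trans (cong (λ r → entry r i) (row-unique j≢l (entry-rowʳ i≢j x y) e)) (entry-rowˡ i≢j x y)
    }

  square-entry : ∀ {i j l} (i≢j : i ≢ j) (i≢l : i ≢ l) (j≢l : j ≢ l) r →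
    LatinSquare.cell (square i≢j i≢l j≢l) (entry r i) (entry r j) ≡ entry r l
  square-entry {l = l} i≢j _ _ r = cong (λ s → entry s l) (row-unique i≢j refl refl)

  -- Columns i and j index the rows by pairs of symbols. Each term is spread over all pairs by
  -- `sum-δ`; after exchanging sums, every pair is met by exactly one row.
  ∑-rows : ∀ {i j} → i ≢ j → ∀ (f : Fin n → Fin n → ℕ) →
    ∑[ r < n ^ 2 ] f (col i r) (col j r) ≡ ∑[ x < n ] ∑[ y < n ] f x y
  ∑-rows {i} {j} i≢j f = begin
    ∑[ r < n ^ 2 ] f (col i r) (col j r)
      ≡⟨ sum-cong-≗ (λ r → trans (sum-cong-≗ (λ x → trans (sum-cong-≗ (λ y → reorder (δ (col i r) x) (δ (col j r) y) (f x y)))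
           (trans (sym (*-distribˡ-sum (δ (col i r) x) (λ y → δ (col j r) y * f x y)))
             (cong (δ (col i r) x *_) (sum-δ (col j r) (f x)))))) (sum-δ (col i r) (λ x → f x (col j r)))) ⟨
    ∑[ r < n ^ 2 ] ∑[ x < n ] ∑[ y < n ] (f x y * at x y r)
      ≡⟨ trans (∑-comm (λ r x → ∑[ y < n ] (f x y * at x y r))) (sum-cong-≗ λ x → ∑-comm (λ r y → f x y * at x y r)) ⟩
    ∑[ x < n ] ∑[ y < n ] ∑[ r < n ^ 2 ] (f x y * at x y r)
      ≡⟨ ∑∑-cong (λ x y → trans (sym (*-distribˡ-sum (f x y) (at x y)))
           (trans (cong (f x y *_) (once x y)) (ℕ.*-identityʳ (f x y)))) ⟩
    ∑[ x < n ] ∑[ y < n ] f x y ∎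
    where
    open ≡-Reasoning
    at : Fin n → Fin n → Fin (n ^ 2) → ℕ
    at x y r = δ (col i r) x * δ (col j r) y
    reorder : ∀ a b c → c * (a * b) ≡ a * (b * c)
    reorder = solve-∀
    once : ∀ x y → sum (at x y) ≡ 1
    once x y = trans (sum-single (at x y) r₀ off)
      (cong₂ _*_ (δ-≡ pˡ) (δ-≡ pʳ))
      where
      r₀ = row i≢j (to x) (to y)
      pˡ : col i r₀ ≡ x
      pˡ = trans (cong from (entry-rowˡ i≢j (to x) (to y))) (strictlyInverseʳ x)
      pʳ : col j r₀ ≡ y
      pʳ = trans (cong from (entry-rowʳ i≢j (to x) (to y))) (strictlyInverseʳ y)
      off : ∀ r → r ≢ r₀ → at x y r ≡ 0
      off r r≢r₀ with col i r Fin.≟ x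
      ... | no p  = cong (_* δ (col j r) y) (δ-≢ p)
      ... | yes p = trans (cong (δ (col i r) x *_) (δ-≢ λ q →
        r≢r₀ (col-injective i≢j (trans p (sym pˡ)) (trans q (sym pʳ))))) (ℕ.*-zeroʳ (δ (col i r) x))

  ∑∑-rows : ∀ {i j} → i ≢ j → ∀ (f : Fin n → Fin n → Fin n → Fin n → ℕ) →
    ∑[ r < n ^ 2 ] ∑[ s < n ^ 2 ] f (col i r) (col j r) (col i s) (col j s) ≡
    ∑[ x < n ] ∑[ y < n ] ∑[ x′ < n ] ∑[ y′ < n ] f x y x′ y′
  ∑∑-rows i≢j f = trans
    (sum-cong-≗ λ r → ∑-rows i≢j (f (col _ r) (col _ r)))
    (∑-rows i≢j (λ x y → ∑[ x′ < n ] ∑[ y′ < n ] f x y x′ y′))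

  ∑-col : ∀ {i j} → i ≢ j → ∀ (f : Fin n → ℕ) → ∑[ r < n ^ 2 ] f (col i r) ≡ n * sum f
  ∑-col i≢j f = trans (∑-rows i≢j (λ x _ → f x))
    (trans (sum-cong-≗ λ x → sum-const n (f x)) (sym (*-distribˡ-sum n f)))

  -- For fixed r, each symbol x′ is the column i entry of exactly one row s that agrees with r in
  -- column l. The factor n counts the rows r with a given symbol in column i.
  ∑∑-agreeing : ∀ {i l} → i ≢ l → ∀ (f : Fin n → Fin n → ℕ) →
    ∑[ r < n ^ 2 ] ∑[ s < n ^ 2 ] (δ (col l r) (col l s) * f (col i r) (col i s)) ≡
    n * ∑[ x < n ] ∑[ x′ < n ] f x x′
  ∑∑-agreeing {i} {l} i≢l f = trans
    (sum-cong-≗ λ r → trans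
      (∑-rows i≢l (λ x′ z′ → δ (col l r) z′ * f (col i r) x′))
      (sum-cong-≗ λ x′ → sum-δ (col l r) (λ _ → f (col i r) x′)))
    (∑-col i≢l (λ x → ∑[ x′ < n ] f x x′))

  -- Isotopy invariance of the parity for even n.

  module _ (n-even : parity n ≡ 0ℙ) where

    -- Both orders are read from the single column i, so `∑∑-agreeing` makes the count a multiple of
    -- n.
    even-discord : ∀ {i l} → i ≢ l → ∀ (f g : Fin n → Fin n) →
      parity (discord (f ∘ col i) (g ∘ col i) (col l)) ≡ 0ℙ
    even-discord {i} {l} i≢l f g = begin
      parity (discord (f ∘ col i) (g ∘ col i) (col l))
        ≡⟨ cong parity (trans (discord-def (f ∘ col i) (g ∘ col i) (col l))
             (∑∑-agreeing i≢l (λ x x′ → lt (f x) (f x′) * lt (g x′) (g x)))) ⟩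
      parity (n * N)          ≡⟨ ℙ.*-homo-* n N ⟩
      parity n ℙ.* parity N   ≡⟨ cong (ℙ._* parity N) n-even ⟩
      0ℙ                      ∎
      where
      open ≡-Reasoning
      N = ∑[ x < n ] ∑[ x′ < n ] (lt (f x) (f x′) * lt (g x′) (g x))

    -- Two triangle relations share the term for `col i` and `g ∘ col j`. Each has one further term
    -- comparing a column with its own relabelling, which is even; modulo 2 the two remaining terms
    -- both equal the shared one.
    discord-relabel : ∀ {i j l} → i ≢ l → j ≢ l → ∀ {f g : Fin n → Fin n} →
      Injective _≡_ _≡_ f → Injective _≡_ _≡_ g →
      parity (discord (f ∘ col i) (g ∘ col j) (col l)) ≡ parity (discord (col i) (col j) (col l))
    discord-relabel {i} {j} {l} i≢l j≢l {f} {g} f-inj g-inj =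
      cancel (discord (f ∘ col i) (col i) (col l)) (discord (col i) (g ∘ col j) (col l)) (discord (f ∘ col i) (g ∘ col j) (col l))
        (discord (col i) (col j) (col l)) (discord (col j) (g ∘ col j) (col l))
        (discord-triangle (f ∘ col i) (col i) (g ∘ col j) (col l)
          (col-injective i≢l ∘ f-inj) (col-injective i≢l) (col-injective j≢l ∘ g-inj))
        (discord-triangle (col i) (col j) (g ∘ col j) (col l)
          (col-injective i≢l) (col-injective j≢l) (col-injective j≢l ∘ g-inj))
        (even-discord i≢l f (λ x → x)) (even-discord j≢l (λ x → x) g)
      where
      cancel : ∀ e b c a e′ → parity (e + b + c) ≡ 0ℙ → parity (a + e′ + b) ≡ 0ℙ →
               parity e ≡ 0ℙ → parity e′ ≡ 0ℙ → parity c ≡ parity a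
      cancel e b c a e′
        rewrite ℙ.+-homo-+ (e + b) c | ℙ.+-homo-+ e b | ℙ.+-homo-+ (a + e′) b | ℙ.+-homo-+ a e′
        with parity e | parity b | parity c | parity a | parity e′
      ... | 0ℙ | 0ℙ | 0ℙ | 0ℙ | 0ℙ = λ _ _ _ _ → refl
      ... | 0ℙ | 1ℙ | 1ℙ | 1ℙ | 0ℙ = λ _ _ _ _ → refl
      ... | 1ℙ | _  | _  | _  | _  = λ _ _ ()
      ... | 0ℙ | _  | _  | _  | 1ℙ = λ _ _ _ ()
      ... | 0ℙ | 0ℙ | 1ℙ | _  | 0ℙ = λ ()
      ... | 0ℙ | 1ℙ | 0ℙ | _  | 0ℙ = λ ()
      ... | 0ℙ | 0ℙ | 0ℙ | 1ℙ | 0ℙ = λ _ ()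
      ... | 0ℙ | 1ℙ | 1ℙ | 0ℙ | 0ℙ = λ _ ()

    -- The count for M becomes a sum over pairs of cells. Reindexing the cells by α and β turns it
    -- into the count for columns i, j, l with i and j relabelled, and `discord-relabel` removes the
    -- relabelling.
    isotopic-parity : ∀ {i j l i′ j′ l′} {L M : LatinSquare Λ} →
      i ≢ j → i ≢ l → j ≢ l → i′ ≢ j′ →
      (∀ r → LatinSquare.cell L (entry r i) (entry r j) ≡ entry r l) →
      (∀ r → LatinSquare.cell M (entry r i′) (entry r j′) ≡ entry r l′) →
      Isotopic L M →
      parity (discord (col i) (col j) (col l)) ≡ parity (discord (col i′) (col j′) (col l′))
    isotopic-parity {i} {j} {l} {i′} {j′} {l′} {L} {M} i≢j i≢l j≢l i′≢j′ L-entry M-entry (α , β , γ , iso) =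
      sym (trans (cong parity chain) (discord-relabel i≢l j≢l (injective α̂) (injective β̂)))
      where
      open ≡-Reasoning
      module L = LatinSquare L
      module M = LatinSquare M

      -- The isotopy permutes Λ; conjugating by `alphabet` gives the corresponding permutations of
      -- `Fin n`.
      conj : _ → Permutation n n
      conj π = ↔-sym alphabet ↔-∘ (π ↔-∘ alphabet)
      α̂ = conj α
      β̂ = conj β
      γ̂ = conj γ

      injective : ∀ (π : Permutation n n) → Injective _≡_ _≡_ (π ⟨$⟩ʳ_)
      injective π = Injection.injective (↔⇒↣ π)

      ℓ : Fin n → Fin n → Fin n
      ℓ x y = from (M.cell (to x) (to y))

      h : Fin n → Fin n → Fin n → Fin n → ℕ
      h x y x′ y′ = δ (ℓ x y) (ℓ x′ y′) * (lt x x′ * lt y′ y)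

      ℓ-col : ∀ r → ℓ (col i′ r) (col j′ r) ≡ col l′ r
      ℓ-col r = cong from (trans (cong₂ M.cell (to-col i′ r) (to-col j′ r)) (M-entry r))

      ℓ-conj : ∀ r → ℓ (α̂ ⟨$⟩ʳ col i r) (β̂ ⟨$⟩ʳ col j r) ≡ γ̂ ⟨$⟩ʳ col l r
      ℓ-conj r = cong from (begin
        M.cell (to (from (Inverse.to α (to (col i r))))) (to (from (Inverse.to β (to (col j r)))))
          ≡⟨ cong₂ M.cell (strictlyInverseˡ _) (strictlyInverseˡ _) ⟩
        M.cell (Inverse.to α (to (col i r))) (Inverse.to β (to (col j r)))
          ≡⟨ iso _ _ ⟩
        Inverse.to γ (L.cell (to (col i r)) (to (col j r)))
          ≡⟨ cong (Inverse.to γ) (trans (cong₂ L.cell (to-col i r) (to-col j r))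
               (trans (L-entry r) (sym (to-col l r)))) ⟩
        Inverse.to γ (to (col l r)) ∎)

      permute₂ : ∀ (f : Fin n → Fin n → ℕ) →
        ∑[ x < n ] ∑[ y < n ] f x y ≡ ∑[ x < n ] ∑[ y < n ] f (α̂ ⟨$⟩ʳ x) (β̂ ⟨$⟩ʳ y)
      permute₂ f = trans (sum-permute (λ x → sum (f x)) α̂) (sum-cong-≗ λ x → sum-permute (f (α̂ ⟨$⟩ʳ x)) β̂)

      chain : discord (col i′) (col j′) (col l′)
            ≡ discord (λ r → α̂ ⟨$⟩ʳ col i r) (λ r → β̂ ⟨$⟩ʳ col j r) (col l)
      chain = begin
        discord (col i′) (col j′) (col l′)
          ≡⟨ discord-def (col i′) (col j′) (col l′) ⟩
        ∑[ r < n ^ 2 ] ∑[ s < n ^ 2 ] (δ (col l′ r) (col l′ s) * (lt (col i′ r) (col i′ s) * lt (col j′ s) (col j′ r)))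
          ≡⟨ ∑∑-cong (λ r s → cong (_* (lt (col i′ r) (col i′ s) * lt (col j′ s) (col j′ r))) (cong₂ δ (ℓ-col r) (ℓ-col s))) ⟨
        ∑[ r < n ^ 2 ] ∑[ s < n ^ 2 ] h (col i′ r) (col j′ r) (col i′ s) (col j′ s)
          ≡⟨ ∑∑-rows i′≢j′ h ⟩
        ∑[ x < n ] ∑[ y < n ] ∑[ x′ < n ] ∑[ y′ < n ] h x y x′ y′
          ≡⟨ permute₂ (λ x y → ∑[ x′ < n ] ∑[ y′ < n ] h x y x′ y′) ⟩
        ∑[ x < n ] ∑[ y < n ] ∑[ x′ < n ] ∑[ y′ < n ] h (α̂ ⟨$⟩ʳ x) (β̂ ⟨$⟩ʳ y) x′ y′
          ≡⟨ ∑∑-cong (λ x y → permute₂ (h (α̂ ⟨$⟩ʳ x) (β̂ ⟨$⟩ʳ y))) ⟩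
        ∑[ x < n ] ∑[ y < n ] ∑[ x′ < n ] ∑[ y′ < n ] h (α̂ ⟨$⟩ʳ x) (β̂ ⟨$⟩ʳ y) (α̂ ⟨$⟩ʳ x′) (β̂ ⟨$⟩ʳ y′)
          ≡⟨ ∑∑-rows i≢j (λ x y x′ y′ → h (α̂ ⟨$⟩ʳ x) (β̂ ⟨$⟩ʳ y) (α̂ ⟨$⟩ʳ x′) (β̂ ⟨$⟩ʳ y′)) ⟨
        ∑[ r < n ^ 2 ] ∑[ s < n ^ 2 ] h (α̂ ⟨$⟩ʳ col i r) (β̂ ⟨$⟩ʳ col j r) (α̂ ⟨$⟩ʳ col i s) (β̂ ⟨$⟩ʳ col j s)
          -- The symbol permutation disappears here, since `δ` only tests equality and γ is
          -- injective.
          ≡⟨ ∑∑-cong (λ r s → cong (_* (lt (α̂ ⟨$⟩ʳ col i r) (α̂ ⟨$⟩ʳ col i s) * lt (β̂ ⟨$⟩ʳ col j s) (β̂ ⟨$⟩ʳ col j r)))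
               (trans (cong₂ δ (ℓ-conj r) (ℓ-conj s)) (δ-injective (injective γ̂) (col l r) (col l s)))) ⟩
        ∑[ r < n ^ 2 ] ∑[ s < n ^ 2 ] (δ (col l r) (col l s) *
            (lt (α̂ ⟨$⟩ʳ col i r) (α̂ ⟨$⟩ʳ col i s) * lt (β̂ ⟨$⟩ʳ col j s) (β̂ ⟨$⟩ʳ col j r)))
          ≡⟨ discord-def (λ r → α̂ ⟨$⟩ʳ col i r) (λ r → β̂ ⟨$⟩ʳ col j r) (col l) ⟨
        discord (λ r → α̂ ⟨$⟩ʳ col i r) (λ r → β̂ ⟨$⟩ʳ col j r) (col l) ∎

    separate : ∀ {i j l i′ j′ l′} → i Fin.< j → j Fin.< l → i′ Fin.< j′ → j′ Fin.< l′ →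
      parity (discord (col i) (col j) (col l)) ≢ parity (discord (col i′) (col j′) (col l′)) →
      ∃₂ λ (L M : LatinSquare Λ) → L ∈ Ensemble A × M ∈ Ensemble A × ¬ Isotopic L M
    separate {i} {j} {l} {i′} {j′} {l′} i<j j<l i′<j′ j′<l′ differ =
      L , M
      , (i , j , l , i<j , j<l , L-entry)
      , (i′ , j′ , l′ , i′<j′ , j′<l′ , M-entry)
      , λ iso → differ (isotopic-parity {L = L} {M} (Fin.<⇒≢ i<j) (Fin.<⇒≢ (Fin.<-trans i<j j<l)) (Fin.<⇒≢ j<l)
                  (Fin.<⇒≢ i′<j′) L-entry M-entry iso)
      where
      L = square (Fin.<⇒≢ i<j) (Fin.<⇒≢ (Fin.<-trans i<j j<l)) (Fin.<⇒≢ j<l)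
      M = square (Fin.<⇒≢ i′<j′) (Fin.<⇒≢ (Fin.<-trans i′<j′ j′<l′)) (Fin.<⇒≢ j′<l′)
      L-entry = square-entry (Fin.<⇒≢ i<j) (Fin.<⇒≢ (Fin.<-trans i<j j<l)) (Fin.<⇒≢ j<l)
      M-entry = square-entry (Fin.<⇒≢ i′<j′) (Fin.<⇒≢ (Fin.<-trans i′<j′ j′<l′)) (Fin.<⇒≢ j′<l′)

-- Arrays with n + 1 columns: agreements between rows.

module Plane {Λ : Set} (A : OA (suc n) n Λ) {o i : Fin (suc n)} (o≢i : o ≢ i) where

  open Derived A

  -- Supplies the second column through which `∑-col` counts the rows.
  another : ∀ c → ∃ λ c′ → c ≢ c′
  another c with c Fin.≟ o
  ... | yes refl = i , o≢i
  ... | no c≢o   = o , c≢o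

  agreements : Fin (n ^ 2) → Fin (n ^ 2) → ℕ
  agreements r s = ∑[ c < suc n ] δ (col c r) (col c s)

  -- Distinct rows agree in at most one column, while a row agrees with itself in all n + 1; the
  -- right side takes the values 1 and n + 1 accordingly.
  agreements-≤ : ∀ r s → agreements r s ≤ 1 + n * δ r s
  agreements-≤ r s with r Fin.≟ s
  ... | yes refl = ℕ.≤-reflexive (begin
    agreements r r           ≡⟨ sum-cong-≗ {suc n} (λ c → δ-≡ {x = col c r} refl) ⟩
    ∑[ c < suc n ] 1         ≡⟨ sum-const (suc n) 1 ⟩
    1 + n * 1                ≡⟨ cong (λ d → 1 + n * d) (δ-≡ {x = r} refl) ⟨
    1 + n * δ r r            ∎)
    where open ≡-Reasoning
  ... | no r≢s with Fin.any? (λ c → col c r Fin.≟ col c s)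
  ...   | yes (c , p) = begin
    agreements r s           ≡⟨ sum-single (λ c → δ (col c r) (col c s)) c (λ c′ c′≢c → δ-≢ λ q → r≢s (col-injective c′≢c q p)) ⟩
    δ (col c r) (col c s)    ≡⟨ δ-≡ p ⟩
    1                        ≤⟨ ℕ.m≤m+n 1 (n * δ r s) ⟩
    1 + n * δ r s            ∎
    where open ℕ.≤-Reasoning
  ...   | no ¬p = begin
    agreements r s           ≡⟨ sum-cong-≗ (λ c → δ-≢ λ p → ¬p (c , p)) ⟩
    ∑[ c < suc n ] 0         ≡⟨ sum-replicate-zero (suc n) ⟩
    0                        ≤⟨ z≤n ⟩
    1 + n * δ r s            ∎
    where open ℕ.≤-Reasoning

  -- Both sides of agreements-≤ have the same sum over s, which forces equality.
  agreements-≡ : ∀ r s → agreements r s ≡ 1 + n * δ r s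
  agreements-≡ r = sum-tight (agreements-≤ r) (begin
    ∑[ s < n ^ 2 ] ∑[ c < suc n ] δ (col c r) (col c s)  ≡⟨ ∑-comm (λ s c → δ (col c r) (col c s)) ⟩
    ∑[ c < suc n ] ∑[ s < n ^ 2 ] δ (col c r) (col c s)
      ≡⟨ sum-cong-≗ (λ c → trans (∑-col (proj₂ (another c)) (δ (col c r))) (cong (n *_) (sum-δ-1 (col c r)))) ⟩
    ∑[ c < suc n ] (n * 1)                               ≡⟨ sum-const (suc n) (n * 1) ⟩
    n * 1 + n * (n * 1)                                  ≡⟨ ℕ.+-comm (n * 1) (n ^ 2) ⟩
    n ^ 2 + n * 1
      ≡⟨ cong₂ _+_ (trans (sum-const (n ^ 2) 1) (ℕ.*-identityʳ (n ^ 2)))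
           (trans (sym (*-distribˡ-sum n (δ r))) (cong (n *_) (sum-δ-1 r))) ⟨
    ∑[ s < n ^ 2 ] 1 + ∑[ s < n ^ 2 ] (n * δ r s)        ≡⟨ ∑-distrib-+ (λ _ → 1) (λ s → n * δ r s) ⟨
    ∑[ s < n ^ 2 ] (1 + n * δ r s)                       ∎)
    where open ≡-Reasoning

  ∑-discord : ∑[ c < suc n ] discord (col o) (col i) (col c) ≡ ascents n * ascents n
  ∑-discord = begin
    ∑[ c < suc n ] discord (col o) (col i) (col c)
      ≡⟨ sum-cong-≗ (λ c → discord-def (col o) (col i) (col c)) ⟩
    ∑[ c < suc n ] ∑[ r < n ^ 2 ] ∑[ s < n ^ 2 ] (D c r s * X r s)
      ≡⟨ trans (∑-comm (λ c r → ∑[ s < n ^ 2 ] (D c r s * X r s))) (sum-cong-≗ λ r → ∑-comm (λ c s → D c r s * X r s)) ⟩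
    ∑[ r < n ^ 2 ] ∑[ s < n ^ 2 ] ∑[ c < suc n ] (D c r s * X r s)
      -- Distinct rows agree exactly once, and for r = s the factor `X r s` vanishes.
      ≡⟨ ∑∑-cong (λ r s → trans (sym (*-distribʳ-sum (X r s) (λ c → D c r s))) (count r s)) ⟩
    ∑[ r < n ^ 2 ] ∑[ s < n ^ 2 ] X r s
      ≡⟨ ∑∑-rows o≢i (λ x y x′ y′ → lt x x′ * lt y′ y) ⟩
    ∑[ x < n ] ∑[ y < n ] ∑[ x′ < n ] ∑[ y′ < n ] (lt x x′ * lt y′ y)
      -- The conditions on x, x′ and on y, y′ are independent, so the fourfold sum factors.
      ≡⟨ ∑∑-cong {n} {n} (λ x y → trans
           (sum-cong-≗ λ x′ → sym (*-distribˡ-sum (lt x x′) (λ y′ → lt y′ y)))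
           (sym (*-distribʳ-sum (below y) (lt x)))) ⟩
    ∑[ x < n ] ∑[ y < n ] (above x * below y)
      ≡⟨ sum-cong-≗ (λ x → sym (*-distribˡ-sum (above x) below)) ⟩
    ∑[ x < n ] (above x * sum below)
      ≡⟨ *-distribʳ-sum (sum below) above ⟨
    ascents n * sum below
      ≡⟨ cong (ascents n *_) (∑-comm {n} {n} (λ y y′ → lt y′ y)) ⟩
    ascents n * ascents n ∎
    where
    open ≡-Reasoning
    D : Fin (suc n) → Fin (n ^ 2) → Fin (n ^ 2) → ℕ
    D c r s = δ (col c r) (col c s)
    X : Fin (n ^ 2) → Fin (n ^ 2) → ℕ
    X r s = lt (col o r) (col o s) * lt (col i s) (col i r)
    above below : Fin n → ℕ
    above x = ∑[ x′ < n ] lt x x′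
    below y = ∑[ y′ < n ] lt y′ y
    count : ∀ r s → agreements r s * X r s ≡ X r s
    count r s with r Fin.≟ s
    ... | yes refl rewrite lt-irrefl {x = col o r} refl = ℕ.*-zeroʳ (agreements r r)
    ... | no r≢s rewrite agreements-≡ r s | δ-≢ r≢s | ℕ.*-zeroʳ n = ℕ.+-identityʳ (X r s)

-- The sum in `∑-discord` also runs over the two ordering columns, which yield no Latin square.
-- Those terms vanish, because rows agreeing in a column are not strictly ordered by it.
discord≡0ˡ : ∀ (F G : Fin m → Fin n) → discord F G F ≡ 0
discord≡0ˡ {m} F G = trans (discord-def F G F) (trans (∑∑-cong zeros) (trans (sum-cong-≗ {m} λ _ → sum-replicate-zero m) (sum-replicate-zero m)))
  where
  zeros : ∀ r s → δ (F r) (F s) * (lt (F r) (F s) * lt (G s) (G r)) ≡ 0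
  zeros r s with F r Fin.≟ F s
  ... | yes p rewrite lt-irrefl p = ℕ.*-zeroʳ (δ (F r) (F s))
  ... | no ¬p rewrite δ-≢ ¬p = refl

discord≡0ʳ : ∀ (F G : Fin m → Fin n) → discord F G G ≡ 0
discord≡0ʳ {m} F G = trans (discord-def F G G) (trans (∑∑-cong zeros) (trans (sum-cong-≗ {m} λ _ → sum-replicate-zero m) (sum-replicate-zero m)))
  where
  zeros : ∀ r s → δ (G r) (G s) * (lt (F r) (F s) * lt (G s) (G r)) ≡ 0
  zeros r s with G r Fin.≟ G s
  ... | yes p rewrite lt-irrefl (sym p) | ℕ.*-zeroʳ (lt (F r) (F s)) = ℕ.*-zeroʳ (δ (G r) (G s))
  ... | no ¬p rewrite δ-≢ ¬p = refl

-- Comparing parities of column triples.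

even-summand : ∀ a b c → parity (a + b + c) ≡ 0ℙ → parity a ≡ 0ℙ ⊎ parity b ≡ 0ℙ ⊎ parity c ≡ 0ℙ
even-summand a b c even with parity a in p | parity b in q | parity c in r
... | 0ℙ | _  | _  = inj₁ refl
... | 1ℙ | 0ℙ | _  = inj₂ (inj₁ refl)
... | 1ℙ | 1ℙ | 0ℙ = inj₂ (inj₂ refl)
... | 1ℙ | 1ℙ | 1ℙ rewrite ℙ.+-homo-+ (a + b) c | ℙ.+-homo-+ a b | p | q | r = contradiction even λ ()

odd≢even : ∀ {p q} → p ≡ 1ℙ → q ≡ 0ℙ → p ≢ q
odd≢even odd even eq = contradiction (trans (sym odd) (trans eq even)) λ ()

even-of-2-mod-4 : ∀ n → n % 4 ≡ 2 → parity n ≡ 0ℙ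
even-of-2-mod-4 n n%4≡2 = trans (cong parity (trans (m≡m%n+[m/n]*n n 4) (cong (_+ n / 4 * 4) n%4≡2)))
  (trans (ℙ.*-homo-* (n / 4) 4) (ℙ.*-zeroʳ (parity (n / 4))))

module _ {Λ : Set} (A : OA (suc n) n Λ) (n%4≡2 : n % 4 ≡ 2) where

  open Derived A

  private
    T : (i j l : Fin (suc n)) → ℕ
    T i j l = discord (col i) (col j) (col l)

  odd-total : ∀ {i j} → i ≢ j → parity (∑[ l < suc n ] T i j l) ≡ 1ℙ
  odd-total {i} {j} i≢j = begin
    parity (∑[ l < suc n ] T i j l)              ≡⟨ cong parity (Plane.∑-discord A i≢j) ⟩
    parity (ascents n * ascents n)               ≡⟨ ℙ.*-homo-* (ascents n) (ascents n) ⟩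
    parity (ascents n) ℙ.* parity (ascents n)    ≡⟨ cong (λ p → p ℙ.* p) (odd-ascents n n%4≡2) ⟩
    1ℙ                                           ∎
    where open ≡-Reasoning

  -- An odd term is nonzero, so it comes from a genuine third column.
  odd⇒distinct : ∀ {i j l} → parity (T i j l) ≡ 1ℙ → i ≢ l × j ≢ l
  odd⇒distinct {i} {j} odd =
      (λ { refl → odd≢even {q = 0ℙ} odd refl (cong parity (discord≡0ˡ (col i) (col j))) })
    , (λ { refl → odd≢even {q = 0ℙ} odd refl (cong parity (discord≡0ʳ (col i) (col j))) })

  even-triple : ∀ {i j k l} → i ≢ l → j ≢ l → k ≢ l →
    parity (T i j l) ≡ 0ℙ ⊎ parity (T j k l) ≡ 0ℙ ⊎ parity (T i k l) ≡ 0ℙ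
  even-triple {i} {j} {k} {l} i≢l j≢l k≢l = even-summand (T i j l) (T j k l) (T i k l)
    (discord-triangle (col i) (col j) (col k) (col l) (col-injective i≢l) (col-injective j≢l) (col-injective k≢l))

  -- The last hypothesis makes i and j the two smallest columns. The column c of the odd term then
  -- lies beyond j, so i, j, c is increasing as `Ensemble` demands. The even term comes from the
  -- triangle relation for i, j, k over the common column l.
  non-isotopic-pair : ∀ {i j k l} → i Fin.< j → j Fin.< k → k Fin.< l →
    (∀ c → i ≢ c → j ≢ c → j Fin.< c) →
    ∃₂ λ (L M : LatinSquare Λ) → L ∈ Ensemble A × M ∈ Ensemble A × ¬ Isotopic L M
  non-isotopic-pair {i} {j} {k} {l} i<j j<k k<l above =
    compare (odd-sum (T i j) (odd-total (Fin.<⇒≢ i<j)))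
      (even-triple (Fin.<⇒≢ (Fin.<-trans i<j j<l)) (Fin.<⇒≢ j<l) (Fin.<⇒≢ k<l))
    where
    j<l = Fin.<-trans j<k k<l
    compare : (∃ λ c → parity (T i j c) ≡ 1ℙ) →
      parity (T i j l) ≡ 0ℙ ⊎ parity (T j k l) ≡ 0ℙ ⊎ parity (T i k l) ≡ 0ℙ →
      ∃₂ λ (L M : LatinSquare Λ) → L ∈ Ensemble A × M ∈ Ensemble A × ¬ Isotopic L M
    compare (c , odd) = λ where
        (inj₁ even)        → separate-from i<j j<l (odd≢even odd even)
        (inj₂ (inj₁ even)) → separate-from j<k k<l (odd≢even odd even)
        (inj₂ (inj₂ even)) → separate-from (Fin.<-trans i<j j<k) k<l (odd≢even odd even)
      where
      j<c = above c (proj₁ (odd⇒distinct odd)) (proj₂ (odd⇒distinct odd))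
      separate-from = λ {i′ j′ l′} → separate (even-of-2-mod-4 n n%4≡2) {i} {j} {c} {i′} {j′} {l′} i<j j<c

corollary6p11 : ∀ (n : ℕ) → n % 4 ≡ 2 → 2 < n →
    ∀ (Λ : Set) (A : OA (suc n) n Λ) →
    ∃₂ λ (L M : LatinSquare Λ) → L ∈ Ensemble A × M ∈ Ensemble A × ¬ Isotopic L M
corollary6p11 2 _ (s≤s (s≤s ()))
corollary6p11 (suc (suc (suc m))) n%4≡2 _ Λ A =
  -- With n = 3 + m there are 4 + m columns, enough for the four that the triangle relation
  -- involves.
  non-isotopic-pair A n%4≡2 {0F} {1F} {2F} {3F} z<s (s<s z<s) (s<s (s<s z<s)) above
  where
  above : ∀ (c : Fin (4 + m)) → 0F ≢ c → 1F ≢ c → Fin._<_ {4 + m} 1F c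
  above 0F            0≢c _   = contradiction refl 0≢c
  above 1F            _   1≢c = contradiction refl 1≢c
  above (suc (suc _)) _   _   = s<s z<s
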